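{- Consider the following nondeterministic program on states $(x,y)\in\mathbb{Z}^2$. Initially $(x,y)$ is an arbitrary element of $\mathbb{Z}^2$ supplied by the user. While $x>0$ and $y>0$, the user chooses a value $\mathrm{control}\in\{1,2\}$ and the following simultaneous assignment is executed (the right-hand sides use the old values): \begin{itemize} \item if $\mathrm{control}=1$: $(x,y)=(x-1,\,x)$; \item if $\mathrm{control}=2$: $(x,y)=(y-2,\,x+1)$. \end{itemize} Then every computation of this program is finite.
   Context: A program is a tuple $(S,I,R)$ where $S$ is a set of states, $I\subseteq S$ is the set of possible initial states, and $R\subseteq S\times S$ is the set of pairs $(s,t)$ such that $s$ satisfies the condition of the while loop and some choice of instruction takes $s$ to $t$ in one iteration of the loop body. A computation is a finite or infinite sequence of states $s_1,s_2,\ldots$ with $s_1\in I$, with $R(s_i,s_{i+1})$ for all consecutive terms, and such that if the sequence is finite with last state $s$ then there is no $t$ with $R(s,t)$. Here $S=I=\mathbb{Z}^2$. -}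

module Defs where

open import Data.Integer using (ℤ; _+_; _-_; _>_; 0ℤ; 1ℤ; +_)
open import Data.Maybe using (Maybe; just; nothing)
open import Data.Nat using (ℕ; zero; suc)
open import Data.Product using (∃-syntax; _×_; _,_)
open import Relation.Binary using (Rel)
open import Relation.Binary.PropositionalEquality using (_≡_)
open import Relation.Nullary using (¬_)
open import Relation.Unary using (Pred; U)
open import Level using (0ℓ)

record Program : Set₁ where
  field
    S : Set
    I : Pred S 0ℓ
    R : Rel S 0ℓ

-- A finite or infinite sequence: a partial function on ℕ (indices start at 0)
-- whose domain is an initial segment, `nothing` meaning "past the end".  Unlike
-- a sum of finite lists and streams, this does not presuppose a decision as to
-- whether the sequence is finite; classically the two presentations agree.
record Sequence (A : Set) : Set where
  field
    at     : ℕ → Maybe A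
    closed : ∀ i → at i ≡ nothing → at (suc i) ≡ nothing

Finite : {A : Set} → Sequence A → Set
Finite s = ∃[ n ] Sequence.at s n ≡ nothing

record IsComputation (P : Program) (c : Sequence (Program.S P)) : Set where
  open Program P
  open Sequence c
  field
    initial     : ∃[ s ] (at zero ≡ just s × I s)
    consecutive : ∀ i {s t} → at i ≡ just s → at (suc i) ≡ just t → R s t
    maximal     : ∀ i {s} → at i ≡ just s → at (suc i) ≡ nothing → ¬ (∃[ t ] R s t)

State : Set
State = ℤ × ℤ

data Control : Set where
  control₁ control₂ : Control

assign : Control → State → State
assign control₁ (x , y) = x - 1ℤ , x
assign control₂ (x , y) = y - + 2 , x + 1ℤ

Guard : Pred State 0ℓ
Guard (x , y) = x > 0ℤ × y > 0ℤ

program : Program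
program = record
  { S = State
  ; I = U
  ; R = λ s t → Guard s × (∃[ control ] t ≡ assign control s)
  }

{-# OPTIONS --safe #-}

-- On ℤ² the quantity max (x + y, 2x, 2y − 3) drops by at least 1 with every
-- execution of the loop body, and it is positive whenever x > 0.

module Submission where

open import Defs

open import Data.Empty using (⊥-elim)
open import Data.Integer using (ℤ; +_; -[1+_]; _+_; _-_; -_; _≤_; _⊔_; ∣_∣; 0ℤ; 1ℤ; -1ℤ; -≤+)
open import Data.Integer.Properties using (≤-trans; ≤-refl; +-monoˡ-≤; +-mono-<; <-≤-trans; <-irrefl; i≤i⊔j; i≤j⊔i; i≤i+j)
open import Data.Integer.Tactic.RingSolver using (solve-∀)
open import Data.Maybe using (just; nothing)
open import Data.Nat using (ℕ; zero; suc)
open import Data.Product using (∃-syntax; _,_; proj₁; proj₂)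
open import Relation.Binary.PropositionalEquality using (_≡_; refl; subst₂)
open import Relation.Nullary using (¬_)

open Program program using (R)

-- Follow the three linear forms x + y, 2x and 2y - 3. Under `control₁` they become 2x - 1, 2x - 2
-- and 2x - 3, all below the old 2x. Under `control₂` the first falls by 1, while the other two
-- trade places, each falling by 1. Hence an upper bound on all three can be lowered by 1 after each
-- iteration (`Bounded-step`). Once the bound is 0, 2x ≤ 0 contradicts the guard
-- (`Bounded-0⇒¬Guard`), so a natural number bounding the initial state limits the number of
-- iterations.

record Bounded (k : ℤ) (s : State) : Set where
  constructor bounded
  field
    sum≤     : proj₁ s + proj₂ s ≤ k
    doubleˣ≤ : proj₁ s + proj₁ s ≤ k
    -- The offset 3 is forced by `control₂`: 2(y - 2) ≤ k allows at most 3, and 2(x + 1) needs at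
    -- least 3.
    doubleʸ≤ : proj₂ s + proj₂ s ≤ k + + 3

-- In the uses below, `slack` is the amount by which a form drops beyond the required 1.
translate-≤ : ∀ c (slack : ℕ) {i j i′ j′} → i + c ≡ i′ → j + c + + slack ≡ j′ → i ≤ j → i′ ≤ j′
translate-≤ c slack i+c≡i′ j+c+slack≡j′ i≤j =
  subst₂ _≤_ i+c≡i′ j+c+slack≡j′ (≤-trans (+-monoˡ-≤ c i≤j) (i≤i+j _ (+ slack)))

-- With `1ℤ + k` on the left, the case k = `+ n` reduces to `+ suc n`, as the induction in
-- `Bounded⇒Finite` needs.
Bounded-step : ∀ {k s t} → Bounded (1ℤ + k) s → R s t → Bounded k t
Bounded-step {k} {x , y} (bounded _ 2x≤1+k _) (_ , control₁ , refl) = bounded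
  (translate-≤ -1ℤ 0 (sum x) (sum-bound k) 2x≤1+k)
  (translate-≤ (- + 2) 1 (doubleˣ x) (doubleˣ-bound k) 2x≤1+k)
  (translate-≤ 0ℤ 2 (doubleʸ x) (doubleʸ-bound k) 2x≤1+k)
  where
  sum : ∀ x → x + x + -1ℤ ≡ x - 1ℤ + x
  sum = solve-∀

  sum-bound : ∀ k → 1ℤ + k + -1ℤ + + 0 ≡ k
  sum-bound = solve-∀

  doubleˣ : ∀ x → x + x + - + 2 ≡ x - 1ℤ + (x - 1ℤ)
  doubleˣ = solve-∀

  doubleˣ-bound : ∀ k → 1ℤ + k + - + 2 + + 1 ≡ k
  doubleˣ-bound = solve-∀

  doubleʸ : ∀ x → x + x + 0ℤ ≡ x + x
  doubleʸ = solve-∀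

  doubleʸ-bound : ∀ k → 1ℤ + k + 0ℤ + + 2 ≡ k + + 3
  doubleʸ-bound = solve-∀
Bounded-step {k} {x , y} (bounded x+y≤1+k 2x≤1+k 2y≤4+k) (_ , control₂ , refl) = bounded
  (translate-≤ -1ℤ 0 (sum x y) (sum-bound k) x+y≤1+k)
  (translate-≤ (- + 4) 0 (doubleˣ y) (doubleˣ-bound k) 2y≤4+k)
  (translate-≤ (+ 2) 0 (doubleʸ x) (doubleʸ-bound k) 2x≤1+k)
  where
  sum : ∀ x y → x + y + -1ℤ ≡ y - + 2 + (x + 1ℤ)
  sum = solve-∀

  sum-bound : ∀ k → 1ℤ + k + -1ℤ + + 0 ≡ k
  sum-bound = solve-∀

  doubleˣ : ∀ y → y + y + - + 4 ≡ y - + 2 + (y - + 2)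
  doubleˣ = solve-∀

  doubleˣ-bound : ∀ k → 1ℤ + k + + 3 + - + 4 + + 0 ≡ k
  doubleˣ-bound = solve-∀

  doubleʸ : ∀ x → x + x + + 2 ≡ x + 1ℤ + (x + 1ℤ)
  doubleʸ = solve-∀

  doubleʸ-bound : ∀ k → 1ℤ + k + + 2 + + 0 ≡ k + + 3
  doubleʸ-bound = solve-∀

Bounded-0⇒¬Guard : ∀ {s} → Bounded 0ℤ s → ¬ Guard s
Bounded-0⇒¬Guard (bounded _ 2x≤0 _) (0<x , _) = <-irrefl refl (<-≤-trans (+-mono-< 0<x 0<x) 2x≤0)

i≤+∣i∣ : ∀ i → i ≤ + ∣ i ∣
i≤+∣i∣ (+ n)    = ≤-refl
i≤+∣i∣ -[1+ n ] = -≤+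

∃-Bounded : ∀ s → ∃[ n ] Bounded (+ n) s
∃-Bounded (x , y) = ∣ m ∣ , bounded
  (≤-trans (i≤i⊔j (x + y) _) (i≤+∣i∣ m))
  (≤-trans (≤-trans (i≤i⊔j (x + x) (y + y)) (i≤j⊔i (x + y) _)) (i≤+∣i∣ m))
  (≤-trans (≤-trans (≤-trans (i≤j⊔i (x + x) (y + y)) (i≤j⊔i (x + y) _)) (i≤+∣i∣ m)) (i≤i+j _ (+ 3)))
  where
  m : ℤ
  -- Any starting bound will do, so 2y stands in for the sharper 2y - 3; the absolute value then
  -- makes the bound a natural number.
  m = (x + y) ⊔ ((x + x) ⊔ (y + y))

module _ {c : Sequence State} (isComputation : IsComputation program c) where
  open Sequence c
  open IsComputation isComputation

  -- Induction on the bound `n`, which serves as fuel: each further state of the computation costs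
  -- one unit, and with none left a further state would violate the guard.
  Bounded⇒Finite : ∀ n i {s} → at i ≡ just s → Bounded (+ n) s → Finite c
  Bounded⇒Finite n i at-i b with at (suc i) in at-1+i
  ... | nothing = suc i , at-1+i
  Bounded⇒Finite zero i at-i b | just t =
    let (guard , _) = consecutive i at-i at-1+i in ⊥-elim (Bounded-0⇒¬Guard b guard)
  Bounded⇒Finite (suc n) i at-i b | just t =
    Bounded⇒Finite n (suc i) at-1+i (Bounded-step b (consecutive i at-i at-1+i))

theorem9p1 : (c : Sequence State) → IsComputation program c → Finite c
theorem9p1 c isComputation =
  let (s , at-0 , _) = IsComputation.initial isComputation
      (n , b)        = ∃-Bounded s
  in Bounded⇒Finite isComputation n 0 at-0 b
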